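{- The only pairs $(n,x)$ of positive integers with $n\geq 2$ satisfying $(2^{n}-2)(10^{n}-2)=x^{2}$ are $(n,x)=(2,14)$ and $(n,x)=(6,7874)$. -}

module Defs where

{-# OPTIONS --safe #-}

-- Even n = 2k: with q = 4^k and c = 5^k the equation is (q - 2)(q c² - 2) = x².
-- Then w = (q - 1) c - x is positive and c divides w² + 2 (q - 2), which for
-- k ≥ 4 is positive and smaller than c. The cases k ≤ 3 are computed.
--
-- Odd n = 2k + 1: (4^k - 1)(5 u² - 1) is a square, where u = 10^k. Every odd
-- divisor of 5 u² - 1 is ±1 mod 5. So if a b (5 u² - 1) is a square with a odd
-- and prime to b, then a is a square times a divisor of 5 u² - 1, hence not
-- ±2 mod 5. This fails for one of a = 4^k - 1, 2^k - 1, 2^k + 1, according to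
-- whether k is odd, 2 mod 4 or 0 mod 4.

module Submission where

open import Data.Empty using (⊥; ⊥-elim)
open import Data.Nat
open import Data.Nat.Properties
open import Data.Nat.Divisibility
open import Data.Nat.DivMod using (m≡m%n+[m/n]*n; m%n<n; %-distribˡ-+; %-distribˡ-*)
open import Data.Nat.GCD using (GCD; gcd; gcd-GCD; gcd[m,n]∣m; gcd[m,n]∣n; gcd[m,n]≢0; GCD-*)
open import Data.Nat.Coprimality using (Coprime; GCD≡1⇒coprime; coprime-divisor)
open import Data.Nat.Induction using (<-rec)
open import Data.Nat.Tactic.RingSolver using (solve-∀)
open import Data.Product using (_×_; _,_; ∃; ∃₂)
open import Data.Nat.Primality using (prime?; prime⇒irreducible; euclidsLemma)
open import Data.Sum using (_⊎_; inj₁; inj₂; reduce)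
open import Function.Bundles using (_⇔_; mk⇔)
open import Relation.Nullary using (¬_; yes; no; contradiction)
open import Relation.Nullary.Decidable using (from-yes; from-no; _→-dec_; ¬?; _⊎-dec_)
open import Relation.Binary.PropositionalEquality
open import Relation.Binary.Definitions using (tri<; tri≈; tri>)
open import Defs

-- Products that are squares.

-- Divide a and s by g = gcd a s to get a′ and s′. Then a′ m = s′² g with a′ prime to s′, so a′
-- divides g, and h is the quotient g / a′.
square-split : ∀ a m s → a > 0 → a * m ≡ s * s →
  ∃ λ h → ∃₂ λ c t → a ≡ h * (c * c) × m ≡ h * (t * t)
square-split a m s a>0 am≡ss with gcd[m,n]∣m a s | gcd[m,n]∣n a s
... | divides a′ a≡ | divides s′ s≡ = h , a′ , s′ , a≡hcc , m≡htt
  where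
  g = gcd a s
  instance
    g≢0 : NonZero g
    g≢0 = ≢-nonZero (gcd[m,n]≢0 a s (inj₁ (m<n⇒n≢0 a>0)))
    a′≢0 : NonZero a′
    a′≢0 = ≢-nonZero λ where refl → m<n⇒n≢0 a>0 a≡
  a′⊥s′ : Coprime a′ s′
  a′⊥s′ = GCD≡1⇒coprime (GCD-* {c = g}
    (subst₂ (λ u v → GCD u v (1 * g)) a≡ s≡
      (subst (GCD a s) (sym (*-identityˡ g)) (gcd-GCD a s))))
  a′m≡s′s′g : a′ * m ≡ s′ * (s′ * g)
  a′m≡s′s′g = *-cancelˡ-≡ _ _ g (begin
    g * (a′ * m)          ≡⟨ lemma₁ g a′ m ⟩
    (a′ * g) * m          ≡⟨ cong (_* m) a≡ ⟨
    a * m                 ≡⟨ am≡ss ⟩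
    s * s                 ≡⟨ cong₂ _*_ s≡ s≡ ⟩
    (s′ * g) * (s′ * g)   ≡⟨ lemma₂ s′ g ⟩
    g * (s′ * (s′ * g))   ∎)
    where
    open ≡-Reasoning
    lemma₁ : ∀ g a m → g * (a * m) ≡ (a * g) * m
    lemma₁ = solve-∀
    lemma₂ : ∀ s g → (s * g) * (s * g) ≡ g * (s * (s * g))
    lemma₂ = solve-∀
  a′∣g : a′ ∣ g
  a′∣g = coprime-divisor a′⊥s′ (coprime-divisor a′⊥s′
    (subst (a′ ∣_) a′m≡s′s′g (m∣m*n m)))
  h = quotient a′∣g
  g≡ha′ : g ≡ h * a′
  g≡ha′ = _∣_.equality a′∣g
  a≡hcc : a ≡ h * (a′ * a′)
  a≡hcc = trans a≡ (trans (cong (a′ *_) g≡ha′) (lemma a′ h))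
    where
    lemma : ∀ a h → a * (h * a) ≡ h * (a * a)
    lemma = solve-∀
  m≡htt : m ≡ h * (s′ * s′)
  m≡htt = *-cancelˡ-≡ _ _ a′
    (trans a′m≡s′s′g (trans (cong (λ z → s′ * (s′ * z)) g≡ha′) (lemma s′ h a′)))
    where
    lemma : ∀ s h a → s * (s * (h * a)) ≡ a * (h * (s * s))
    lemma = solve-∀

-- Parity and congruences between squares.

even⊎odd : ∀ n → ∃ λ k → n ≡ 2 * k ⊎ n ≡ 1 + 2 * k
even⊎odd zero = 0 , inj₁ refl
even⊎odd (suc n) with even⊎odd n
... | k , inj₁ refl = k , inj₂ refl
... | k , inj₂ refl = suc k , inj₁ (sym (*-suc 2 k))

odd⇒even-suc : ∀ {n} → ¬ 2 ∣ n → 2 ∣ suc n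
odd⇒even-suc {n} 2∤n with even⊎odd n
... | k , inj₁ refl = contradiction (m∣m*n k) 2∤n
... | k , inj₂ refl = divides (suc k) (lemma k)
  where
  lemma : ∀ k → 2 + 2 * k ≡ suc k * 2
  lemma = solve-∀

infix 4 _≡_[mod_]
-- A multiple of d is allowed on each side, so that congruences are handled without subtraction.
_≡_[mod_] : ℕ → ℕ → ℕ → Set
a ≡ b [mod d ] = ∃₂ λ i j → a + i * d ≡ b + j * d

square-mod : ∀ {d c} x .{{_ : NonZero d}} → x * x ≡ c [mod d ] → (x % d) * (x % d) ≡ c [mod d ]
square-mod {d} x (i , j , eq) = 2 * (x % d) * (x / d) + (x / d) * (x / d) * d + i , j ,
  trans (lemma (x % d) (x / d) d i)
        (trans (cong (λ z → z * z + i * d) (sym (m≡m%n+[m/n]*n x d))) eq)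
  where
  lemma : ∀ r k d i → r * r + (2 * r * k + k * k * d + i) * d
        ≡ (r + k * d) * (r + k * d) + i * d
  lemma = solve-∀

-- This is (d - r)² ≡ r², from the subtraction-free identity s² + r (s + r) = r² + s (s + r).
square-neg : ∀ {d c r s} → s + r ≡ d → r * r ≡ c [mod d ] → s * s ≡ c [mod d ]
square-neg {c = c} {r} {s} refl (i , j , eq) = r + i , s + j ,
  trans (lemma₁ r s i) (trans (cong (_+ s * (s + r)) eq) (lemma₂ c s r j))
  where
  lemma₁ : ∀ r s i → s * s + (r + i) * (s + r) ≡ (r * r + i * (s + r)) + s * (s + r)
  lemma₁ = solve-∀
  lemma₂ : ∀ c s r j → (c + j * (s + r)) + s * (s + r) ≡ c + (s + j) * (s + r)
  lemma₂ = solve-∀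

-- As d is odd, one of x % d and its complement to d is even. An even root is what keeps the
-- cofactor odd in the descent below.
even-root : ∀ {d c x} → ¬ 2 ∣ d → x * x ≡ c [mod d ] →
  ∃ λ r → r < d × 2 ∣ r × r * r ≡ c [mod d ]
even-root {zero} 2∤d _ = contradiction (2 ∣0) 2∤d
even-root {d@(suc _)} {x = x} 2∤d x²≡c with 2 ∣? x % d
... | yes 2∣r = x % d , m%n<n x d , 2∣r , square-mod x x²≡c
... | no 2∤r = s , s<d , 2∣s , square-neg {r = r} {s} s+r≡d (square-mod x x²≡c)
  where
  r = x % d
  s = d ∸ r
  s+r≡d : s + r ≡ d
  s+r≡d = m∸n+n≡m (<⇒≤ (m%n<n x d))
  s<d : s < d
  -- An odd r is nonzero, so its complement stays strictly below d.
  s<d = ∸-monoʳ-< {d} {r} {0} (n≢0⇒n>0 λ r≡0 → 2∤r (subst (2 ∣_) (sym r≡0) (2 ∣0))) (<⇒≤ (m%n<n x d))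
  2∣s : 2 ∣ s
  2∣s = ∣m+n∣m⇒∣n (subst (2 ∣_) (trans (cong suc (sym s+r≡d)) (cong suc (+-comm s r))) (odd⇒even-suc 2∤d)) (odd⇒even-suc 2∤r)

mod⇒∣ : ∀ {d a b} → a ≡ b [mod d ] → ∀ {e} → a ≡ b + e → d ∣ e
mod⇒∣ {d} {a} {b} (i , j , eq) {e} refl = ∣m+n∣m⇒∣n (divides j i*d+e≡j*d) (divides-refl i)
  where
  i*d+e≡j*d : i * d + e ≡ j * d
  i*d+e≡j*d = +-cancelˡ-≡ b _ _ (trans (lemma b (i * d) e) eq)
    where
    lemma : ∀ b u e → b + (u + e) ≡ b + e + u
    lemma = solve-∀

-- Finite checks modulo 5.

-- Here and below, (d * d) % 5 ≡ 1 encodes d ≡ ±1 mod 5.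
cofactor-residues : ∀ {f} → f < 5 → ∀ {d} → d < 5 → ∀ {r} → r < 5 →
  (f * f) % 5 ≡ 1 → d ≢ 0 → (f * d + 5) % 5 ≡ (r * r) % 5 → (d * d) % 5 ≡ 1
cofactor-residues = from-yes (allUpTo? (λ f → allUpTo? (λ d → allUpTo? (λ r →
  ((f * f) % 5 ≟ 1) →-dec (¬? (d ≟ 0) →-dec (((f * d + 5) % 5 ≟ (r * r) % 5) →-dec ((d * d) % 5 ≟ 1)))) 5) 5) 5)

negative-inverse-residues : ∀ {g} → g < 5 → ∀ {d} → d < 5 →
  (g * g) % 5 ≡ 1 → (g * d + 1) % 5 ≡ 0 → (d * d) % 5 ≡ 1
negative-inverse-residues = from-yes (allUpTo? (λ g → allUpTo? (λ d →
  ((g * g) % 5 ≟ 1) →-dec (((g * d + 1) % 5 ≟ 0) →-dec ((d * d) % 5 ≟ 1))) 5) 5)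

square-multiple-residues : ∀ {h} → h < 5 → ∀ {c} → c < 5 → (h * h) % 5 ≡ 1 →
  ¬ ((h * ((c * c) % 5)) % 5 ≡ 2 ⊎ (h * ((c * c) % 5)) % 5 ≡ 3)
square-multiple-residues = from-yes (allUpTo? (λ h → allUpTo? (λ c → ((h * h) % 5 ≟ 1) →-dec
  ¬? (((h * ((c * c) % 5)) % 5 ≟ 2) ⊎-dec ((h * ((c * c) % 5)) % 5 ≟ 3))) 5) 5)

residue< : ∀ m → m % 5 < 5
residue< m = m%n<n m 5

square-% : ∀ m → (m * m) % 5 ≡ ((m % 5) * (m % 5)) % 5
square-% m = %-distribˡ-* m m 5

*+-% : ∀ a b c → (a * b + c) % 5 ≡ ((a % 5) * (b % 5) + c) % 5
*+-% a b c = begin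
  (a * b + c) % 5                            ≡⟨ %-distribˡ-+ (a * b) c 5 ⟩
  ((a * b) % 5 + c % 5) % 5                  ≡⟨ cong (λ z → (z + c % 5) % 5) (%-distribˡ-* a b 5) ⟩
  (((a % 5) * (b % 5)) % 5 + c % 5) % 5      ≡⟨ %-distribˡ-+ ((a % 5) * (b % 5)) c 5 ⟨
  ((a % 5) * (b % 5) + c) % 5                ∎
  where open ≡-Reasoning

-- Descent: moduli for which 5 is a square.

Descends : ℕ → Set
Descends d = ∀ x → ¬ 2 ∣ d → ¬ 5 ∣ d → x * x ≡ 5 [mod d ] → (d * d) % 5 ≡ 1

-- The descent passes from d to its cofactor f in r² - 5. Since r < d, also f < d; since r is even
-- and 5 is odd, f is odd; and the same r shows that 5 is a square modulo f.
module _ (d f r : ℕ) (rec : ∀ {f} → f < d → Descends f) (2∤d : ¬ 2 ∣ d) (5∤d : ¬ 5 ∣ d)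
         (r<d : r < d) (2∣r : 2 ∣ r) (r²≡fd+5 : r * r ≡ f * d + 5) where

  private
    f<d : f < d
    f<d = *-cancelʳ-< d f d (≤-<-trans (m≤m+n (f * d) 5) (subst (_< d * d) r²≡fd+5 (*-mono-< r<d r<d)))

    2∤f : ¬ 2 ∣ f
    2∤f 2∣f = from-no (2 ∣? 5)
      (∣m+n∣m⇒∣n (subst (2 ∣_) r²≡fd+5 (∣m⇒∣m*n r 2∣r)) (∣m⇒∣m*n d 2∣f))

  -- Induction gives f ≡ ±1 mod 5, and f d ≡ r² is 0 or ±1 mod 5. As 5 does not divide d, this
  -- leaves d ≡ ±1.
  descent-5∤ : ¬ 5 ∣ f → (d * d) % 5 ≡ 1
  descent-5∤ 5∤f = trans (square-% d)
    (cofactor-residues (residue< f) (residue< d) (residue< r)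
      (trans (sym (square-% f)) (rec f<d r 2∤f 5∤f r²≡5))
      (λ d%5≡0 → 5∤d (m%n≡0⇒n∣m d 5 d%5≡0))
      (trans (sym (*+-% f d 5)) (trans (cong (_% 5) (sym r²≡fd+5)) (square-% r))))
    where
    r²≡5 : r * r ≡ 5 [mod f ]
    r²≡5 = 0 , d , trans (+-identityʳ _) (trans r²≡fd+5 (lemma f d))
      where
      lemma : ∀ f d → f * d + 5 ≡ 5 + d * f
      lemma = solve-∀

  -- Induction does not apply to f itself, so it is applied to g = f / 5. Dividing r² = f d + 5 by 5
  -- gives g d + 1 = 5 t², so g is prime to 5 and g d ≡ -1 mod 5.
  descent-5∣ : ∀ g t → f ≡ g * 5 → r ≡ t * 5 → (d * d) % 5 ≡ 1
  descent-5∣ g t f≡g*5 r≡t*5 = trans (square-% d)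
    (negative-inverse-residues (residue< g) (residue< d)
      (trans (sym (square-% g)) (rec g<d r 2∤g 5∤g r²≡5))
      (trans (sym (*+-% g d 1)) (n∣m⇒m%n≡0 _ 5 5∣gd+1)))
    where
    r²≡5gd+5 : r * r ≡ g * 5 * d + 5
    r²≡5gd+5 = trans r²≡fd+5 (cong (λ z → z * d + 5) f≡g*5)
    r²≡5 : r * r ≡ 5 [mod g ]
    r²≡5 = 0 , 5 * d , trans (+-identityʳ _) (trans r²≡5gd+5 (lemma g d))
      where
      lemma : ∀ g d → g * 5 * d + 5 ≡ 5 + (5 * d) * g
      lemma = solve-∀
    gd+1≡5t² : g * d + 1 ≡ 5 * (t * t)
    gd+1≡5t² = *-cancelˡ-≡ _ _ 5 (begin
      5 * (g * d + 1)    ≡⟨ lemma₁ g d ⟩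
      g * 5 * d + 5      ≡⟨ r²≡5gd+5 ⟨
      r * r              ≡⟨ cong₂ _*_ r≡t*5 r≡t*5 ⟩
      (t * 5) * (t * 5)  ≡⟨ lemma₂ t ⟩
      5 * (5 * (t * t))  ∎)
      where
      open ≡-Reasoning
      lemma₁ : ∀ g d → 5 * (g * d + 1) ≡ g * 5 * d + 5
      lemma₁ = solve-∀
      lemma₂ : ∀ t → (t * 5) * (t * 5) ≡ 5 * (5 * (t * t))
      lemma₂ = solve-∀
    5∣gd+1 : 5 ∣ g * d + 1
    5∣gd+1 = subst (5 ∣_) (sym gd+1≡5t²) (m∣m*n (t * t))
    g<d : g < d
    g<d = ≤-<-trans (subst (g ≤_) (sym f≡g*5) (m≤m*n g 5)) f<d
    2∤g : ¬ 2 ∣ g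
    2∤g 2∣g = 2∤f (subst (2 ∣_) (sym f≡g*5) (∣m⇒∣m*n 5 2∣g))
    5∤g : ¬ 5 ∣ g
    5∤g 5∣g = from-no (5 ∣? 1) (∣m+n∣m⇒∣n 5∣gd+1 (∣m⇒∣m*n d 5∣g))

  descent-step : (d * d) % 5 ≡ 1
  descent-step with 5 ∣? f
  ... | no 5∤f = descent-5∤ 5∤f
  ... | yes 5∣f@(divides g f≡g*5) with reduce (euclidsLemma r r (from-yes (prime? 5)) 5∣r²)
    where
    5∣r² : 5 ∣ r * r
    5∣r² = subst (5 ∣_) (sym r²≡fd+5) (∣m∣n⇒∣m+n (∣m⇒∣m*n d 5∣f) ∣-refl)
  ...   | divides t r≡t*5 = descent-5∣ g t f≡g*5 r≡t*5

-- The roots 0 and 2 end the descent: their squares are below 5, so r² - 5 is not a natural number.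
even⇒0∨2∨square≥5 : ∀ r → 2 ∣ r → r ≡ 0 ⊎ r ≡ 2 ⊎ ∃ λ e → r * r ≡ 5 + e
even⇒0∨2∨square≥5 0 _ = inj₁ refl
even⇒0∨2∨square≥5 1 2∣1 = contradiction 2∣1 (from-no (2 ∣? 1))
even⇒0∨2∨square≥5 2 _ = inj₂ (inj₁ refl)
even⇒0∨2∨square≥5 r@(suc (suc (suc u))) _ = inj₂ (inj₂ (4 + 6 * u + u * u , lemma u))
  where
  lemma : ∀ u → (3 + u) * (3 + u) ≡ 5 + (4 + 6 * u + u * u)
  lemma = solve-∀

mod-sym : ∀ {d a b} → a ≡ b [mod d ] → b ≡ a [mod d ]
mod-sym (i , j , eq) = j , i , sym eq

-- A case of quadratic reciprocity for 5, by descent on d.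
divisor-of-square-minus-5 : ∀ d → Descends d
divisor-of-square-minus-5 = <-rec Descends step
  where
  step : ∀ d → (∀ {f} → f < d → Descends f) → Descends d
  step d rec x 2∤d 5∤d x²≡5 with even-root {x = x} 2∤d x²≡5
  ... | r , r<d , 2∣r , r²≡5 with even⇒0∨2∨square≥5 r 2∣r
  ...   | inj₂ (inj₂ (e , r²≡5+e)) = descent-step d (quotient d∣e) r rec 2∤d 5∤d r<d 2∣r r²≡fd+5
    where
    d∣e : d ∣ e
    d∣e = mod⇒∣ r²≡5 r²≡5+e
    r²≡fd+5 : r * r ≡ quotient d∣e * d + 5
    r²≡fd+5 = trans r²≡5+e (trans (cong (5 +_) (_∣_.equality d∣e)) (+-comm 5 _))
  -- For r = 2, d divides 5 - 4 = 1.
  ...   | inj₂ (inj₁ refl) with ∣1⇒≡1 (mod⇒∣ (mod-sym r²≡5) refl)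
  ...     | refl = refl
  step d rec x 2∤d 5∤d x²≡5
      | r , r<d , 2∣r , r²≡5 | inj₁ refl
      -- For r = 0, d divides 5, hence is 1 or 5.
      with prime⇒irreducible (from-yes (prime? 5)) (mod⇒∣ (mod-sym r²≡5) refl)
  ...     | inj₁ refl = refl
  ...     | inj₂ refl = contradiction ∣-refl 5∤d

-- Divisors of 5 u² - 1 and their square multiples.

residue-times-square : ∀ h v → (h * h) % 5 ≡ 1 →
  ¬ ((h * (v * v)) % 5 ≡ 2 ⊎ (h * (v * v)) % 5 ≡ 3)
residue-times-square h v h²≡1 = subst (λ z → ¬ (z ≡ 2 ⊎ z ≡ 3)) (sym hv²%5)
  (square-multiple-residues (residue< h) (residue< v) (trans (sym (square-% h)) h²≡1))
  where
  hv²%5 : (h * (v * v)) % 5 ≡ ((h % 5) * ((((v % 5) * (v % 5))) % 5)) % 5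
  hv²%5 = trans (%-distribˡ-* h (v * v) 5) (cong (λ z → ((h % 5) * z) % 5) (square-% v))

-- Multiplying 5 u² = 1 + k h by 5 gives (5 u)² = 5 + 5 k h, so 5 u is a square root of 5 modulo h.
divisor-of-5u²-1 : ∀ h k u → ¬ 2 ∣ h → suc (k * h) ≡ 5 * (u * u) → (h * h) % 5 ≡ 1
divisor-of-5u²-1 h k u 2∤h 1+kh≡5u² = divisor-of-square-minus-5 h (5 * u) 2∤h 5∤h
  (0 , 5 * k , trans (lemma₁ u) (trans (cong (5 *_) (sym 1+kh≡5u²)) (lemma₂ k h)))
  where
  5∤h : ¬ 5 ∣ h
  5∤h 5∣h = from-no (5 ∣? 1) (∣m+n∣m⇒∣n
    (subst (5 ∣_) (trans (sym 1+kh≡5u²) (+-comm 1 (k * h))) (m∣m*n (u * u))) (∣n⇒∣m*n k 5∣h))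
  lemma₁ : ∀ u → (5 * u) * (5 * u) + 0 ≡ 5 * (5 * (u * u))
  lemma₁ = solve-∀
  lemma₂ : ∀ k h → 5 * suc (k * h) ≡ 5 + 5 * k * h
  lemma₂ = solve-∀

-- Write a = h v² and b c = h t². As h divides a, it is prime to b, so it divides c = 5 u² - 1 and
-- is ±1 mod 5; multiplying by v² cannot give ±2.
square-factor-residue : ∀ a b c u x → a > 0 → ¬ 2 ∣ a → Coprime a b →
  suc c ≡ 5 * (u * u) → a * (b * c) ≡ x * x → ¬ (a % 5 ≡ 2 ⊎ a % 5 ≡ 3)
square-factor-residue a b c u x a>0 2∤a a⊥b 1+c≡5u² abc≡x² =
  from-split (square-split a (b * c) x a>0 abc≡x²)
  where
  from-split : (∃ λ h → ∃₂ λ v t → a ≡ h * (v * v) × b * c ≡ h * (t * t)) →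
    ¬ (a % 5 ≡ 2 ⊎ a % 5 ≡ 3)
  from-split (h , v , t , a≡hv² , bc≡ht²) = subst (λ z → ¬ (z % 5 ≡ 2 ⊎ z % 5 ≡ 3)) (sym a≡hv²)
    (residue-times-square h v (from-divisor (coprime-divisor h⊥b h∣bc)))
    where
    h∣a : h ∣ a
    h∣a = divides (v * v) (trans a≡hv² (*-comm h (v * v)))
    h⊥b : Coprime h b
    h⊥b (d∣h , d∣b) = a⊥b (∣-trans d∣h h∣a , d∣b)
    h∣bc : h ∣ b * c
    h∣bc = divides (t * t) (trans bc≡ht² (*-comm h (t * t)))
    from-divisor : h ∣ c → (h * h) % 5 ≡ 1
    from-divisor (divides k c≡kh) = divisor-of-5u²-1 h k u (λ 2∣h → 2∤a (∣-trans 2∣h h∣a))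
      (trans (cong suc (sym c≡kh)) 1+c≡5u²)

-- Odd exponents: choosing a factor that is ±2 mod 5.

∣m+n∣n⇒∣m : ∀ {d} m {n} → d ∣ m + n → d ∣ n → d ∣ m
∣m+n∣n⇒∣m {d} m {n} d∣m+n = ∣m+n∣m⇒∣n (subst (d ∣_) (+-comm m n) d∣m+n)

coprime-suc : ∀ m → Coprime m (suc m)
coprime-suc m (d∣m , d∣1+m) = ∣1⇒≡1 (∣m+n∣n⇒∣m 1 d∣1+m d∣m)

-- Being prime to a multiple q of 4, a is prime to 4. A common divisor of a and 4 b thus divides b,
-- hence 2, hence q, and so is 1.
coprime-4* : ∀ {a b q} → 4 ∣ q → Coprime a q → (∀ {d} → d ∣ a → d ∣ b → d ∣ 2) → Coprime a (4 * b)
coprime-4* 4∣q a⊥q common∣2 {d} (d∣a , d∣4b) =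
  a⊥q (d∣a , ∣-trans (common∣2 d∣a (coprime-divisor d⊥4 d∣4b)) (∣-trans (divides 2 refl) 4∣q))
  where
  d⊥4 : Coprime d 4
  d⊥4 (e∣d , e∣4) = a⊥q (∣-trans e∣d d∣a , ∣-trans e∣4 4∣q)

coprime-4⇒odd : ∀ {a q} → 4 ∣ q → Coprime a q → ¬ 2 ∣ a
coprime-4⇒odd 4∣q a⊥q 2∣a = contradiction (a⊥q (2∣a , ∣-trans (divides 2 refl) 4∣q)) λ ()

16^n%5≡1 : ∀ n → 16 ^ n % 5 ≡ 1
16^n%5≡1 zero = refl
16^n%5≡1 (suc n) = trans (%-distribˡ-* 16 (16 ^ n) 5) (cong (λ z → (1 * z) % 5) (16^n%5≡1 n))

4*16^n%5≡4 : ∀ n → (4 * 16 ^ n) % 5 ≡ 4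
4*16^n%5≡4 n = trans (%-distribˡ-* 4 (16 ^ n) 5) (cong (λ z → (4 * z) % 5) (16^n%5≡1 n))

pred-residue : ∀ p → suc p % 5 ≡ 4 → p % 5 ≡ 3
pred-residue p 1+p≡4 = table (residue< p) (trans (sym (%-distribˡ-+ 1 p 5)) 1+p≡4)
  where
  table : ∀ {r} → r < 5 → (1 + r) % 5 ≡ 4 → r ≡ 3
  table = from-yes (allUpTo? (λ r → ((1 + r) % 5 ≟ 4) →-dec (r ≟ 3)) 5)

4^[2n]≡16^n : ∀ n → 4 ^ (2 * n) ≡ 16 ^ n
4^[2n]≡16^n n = sym (^-*-assoc 4 2 n)

no-square-odd-exponent : ∀ k a c u x → k > 0 → suc a ≡ 4 ^ k → suc c ≡ 5 * (u * u) → a * (4 * c) ≡ x * x → ⊥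
no-square-odd-exponent k a c u x k>0 1+a≡4^k 1+c≡5u² eq with even⊎odd k
-- For odd k, a = 4 * 16^j - 1 ≡ 3 mod 5 serves as a whole, with cofactor b = 1 beside the 4.
... | j , inj₂ refl = square-factor-residue a (4 * 1) c u x a>0 (coprime-4⇒odd 4∣1+a (coprime-suc a))
        (coprime-4* 4∣1+a (coprime-suc a) (λ _ d∣1 → ∣-trans d∣1 (1∣ 2))) 1+c≡5u² eq
        (inj₂ a%5≡3)
  where
  1+a≡4*16^j : suc a ≡ 4 * 16 ^ j
  1+a≡4*16^j = trans 1+a≡4^k (cong (4 *_) (4^[2n]≡16^n j))
  4∣1+a : 4 ∣ suc a
  4∣1+a = subst (4 ∣_) (sym 1+a≡4*16^j) (m∣m*n (16 ^ j))
  a%5≡3 : a % 5 ≡ 3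
  a%5≡3 = pred-residue a (trans (cong (_% 5) 1+a≡4*16^j) (4*16^n%5≡4 j))
  a>0 : a > 0
  a>0 = n≢0⇒n>0 λ a≡0 → contradiction (trans (sym a%5≡3) (cong (_% 5) a≡0)) λ ()
... | l , inj₁ refl = by-parity (even⊎odd l)
  where
  -- With k = 2 l, 4^l is 2^k, so p and 2 + p are the factors 2^k - 1 and 2^k + 1 of a.
  p = pred (4 ^ l)
  1+p≡4^l : suc p ≡ 4 ^ l
  1+p≡4^l = suc-pred (4 ^ l) {{m^n≢0 4 l}}
  a≡p[2+p] : a ≡ p * (2 + p)
  a≡p[2+p] = suc-injective (begin
    suc a             ≡⟨ 1+a≡4^k ⟩
    4 ^ (2 * l)       ≡⟨ cong (4 ^_) (*-comm 2 l) ⟩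
    4 ^ (l * 2)       ≡⟨ ^-*-assoc 4 l 2 ⟨
    (4 ^ l) ^ 2       ≡⟨ cong (_^ 2) 1+p≡4^l ⟨
    (suc p) ^ 2       ≡⟨ lemma p ⟩
    suc (p * (2 + p)) ∎)
    where
    open ≡-Reasoning
    lemma : ∀ p → suc p * (suc p * 1) ≡ suc (p * (2 + p))
    lemma = solve-∀
  p[2+p]4c≡x² : (p * (2 + p)) * (4 * c) ≡ x * x
  p[2+p]4c≡x² = subst (λ z → z * (4 * c) ≡ x * x) a≡p[2+p] eq
  4∣1+p : 4 ∣ suc p
  4∣1+p = subst (4 ∣_) (sym 1+p≡4^l) (4∣4^ l (n≢0⇒n>0 λ where refl → n≮0 k>0))
    where
    4∣4^ : ∀ l → l > 0 → 4 ∣ 4 ^ l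
    4∣4^ (suc l) _ = m∣m*n (4 ^ l)
  by-parity : ∃ (λ i → l ≡ 2 * i ⊎ l ≡ 1 + 2 * i) → ⊥
  -- Here 4^l = 16^i ≡ 1 mod 5, so 2 + p ≡ 2.
  by-parity (i , inj₁ refl) =
    square-factor-residue (2 + p) (4 * p) c u x (s≤s z≤n) (coprime-4⇒odd 4∣1+p 2+p⊥1+p)
      (coprime-4* 4∣1+p 2+p⊥1+p λ d∣2+p d∣p → ∣m+n∣n⇒∣m 2 d∣2+p d∣p)
      1+c≡5u² (trans (lemma p c) p[2+p]4c≡x²)
      (inj₁ (trans (%-distribˡ-+ 1 (suc p) 5) (cong (λ z → (1 + z) % 5)
        (trans (cong (_% 5) (trans 1+p≡4^l (4^[2n]≡16^n i))) (16^n%5≡1 i)))))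
    where
    2+p⊥1+p : Coprime (2 + p) (suc p)
    2+p⊥1+p (d∣2+p , d∣1+p) = coprime-suc (suc p) (d∣1+p , d∣2+p)
    lemma : ∀ p c → (2 + p) * (4 * p * c) ≡ (p * (2 + p)) * (4 * c)
    lemma = solve-∀
  -- Here 4^l = 4 * 16^i ≡ 4 mod 5, so p ≡ 3.
  by-parity (i , inj₂ refl) =
    square-factor-residue p (4 * (2 + p)) c u x p>0 (coprime-4⇒odd 4∣1+p (coprime-suc p))
      (coprime-4* 4∣1+p (coprime-suc p) λ d∣p d∣2+p → ∣m+n∣n⇒∣m 2 d∣2+p d∣p)
      1+c≡5u² (trans (lemma p c) p[2+p]4c≡x²) (inj₂ p%5≡3)
    where
    p%5≡3 : p % 5 ≡ 3
    p%5≡3 = pred-residue p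
      (trans (cong (_% 5) (trans 1+p≡4^l (cong (4 *_) (4^[2n]≡16^n i)))) (4*16^n%5≡4 i))
    p>0 : p > 0
    p>0 = n≢0⇒n>0 λ p≡0 → contradiction (trans (sym p%5≡3) (cong (_% 5) p≡0)) λ ()
    lemma : ∀ p c → p * (4 * (2 + p) * c) ≡ (p * (2 + p)) * (4 * c)
    lemma = solve-∀

-- Even exponents: the size argument.

-- With N = m + 1 and w = N c - x, the equation becomes
-- 2 N c w = c² + 2 m + w², so c divides 2 m + w². Also N w ≤ c + 1, and under
-- the two size hypotheses this makes 2 m + w² smaller than c.
even-exponent-large : ∀ m c x → m * ((2 + m) * (c * c)) ≡ x * x + 2 * m →
  16 * (2 + m) ≤ 7 * c → 64 * c ≤ (2 + m) * (2 + m) → ⊥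
even-exponent-large m zero x _ ()
even-exponent-large m c@(suc _) x eq 16q≤7c 64c≤q² = main (m≤n⇒∃[o]m+o≡n (<⇒≤ x<Nc))
  where
  Nc = suc m * c
  -- Adding c² to the equation completes the square, since m (m + 2) + 1 = N².
  N²c² : Nc * Nc ≡ x * x + (2 * m + c * c)
  N²c² = trans (lemma m c) (trans (cong (_+ c * c) eq) (+-assoc (x * x) (2 * m) (c * c)))
    where
    lemma : ∀ m c → (suc m * c) * (suc m * c) ≡ m * ((2 + m) * (c * c)) + c * c
    lemma = solve-∀
  x<Nc : x < Nc
  x<Nc = ≰⇒> λ Nc≤x → <⇒≱ (subst (x * x <_) (sym N²c²)
    (m<m+n (x * x) (≤-trans z<s (m≤n+m (c * c) (2 * m))))) (*-mono-≤ Nc≤x Nc≤x)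
  2m≤c : 2 * m ≤ c
  2m≤c = *-cancelˡ-≤ 8 (begin
    8 * (2 * m)            ≡⟨ lemma m ⟩
    16 * m                 ≤⟨ *-monoʳ-≤ 16 (m≤n+m m 2) ⟩
    16 * (2 + m)           ≤⟨ 16q≤7c ⟩
    7 * c                  ≤⟨ *-monoˡ-≤ c (n≤1+n 7) ⟩
    8 * c                  ∎)
    where
    open ≤-Reasoning
    lemma : ∀ m → 8 * (2 * m) ≡ 16 * m
    lemma = solve-∀
  5≤c : 5 ≤ c
  5≤c = ≮⇒≥ λ c<5 → from-no (32 ≤? 28) (begin
    16 * 2          ≤⟨ *-monoʳ-≤ 16 (m≤m+n 2 m) ⟩
    16 * (2 + m)    ≤⟨ 16q≤7c ⟩
    7 * c           ≤⟨ *-monoʳ-≤ 7 (≤-pred c<5) ⟩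
    7 * 4           ∎)
    where open ≤-Reasoning
  main : ∃ (λ w → x + w ≡ Nc) → ⊥
  main (zero , x+0≡Nc) = <⇒≢ x<Nc (trans (sym (+-identityʳ x)) x+0≡Nc)
  main (w@(suc _) , x+w≡Nc) = <⇒≱ v<c (∣⇒≤ {{>-nonZero (≤-trans z<s (m≤n+m (w * w) (2 * m)))}} c∣v)
    where
    v = 2 * m + w * w
    2xw+w² : 2 * x * w + w * w ≡ 2 * m + c * c
    2xw+w² = +-cancelˡ-≡ (x * x) _ _
      (trans (lemma x w) (trans (cong (λ z → z * z) x+w≡Nc) N²c²))
      where
      lemma : ∀ x w → x * x + (2 * x * w + w * w) ≡ (x + w) * (x + w)
      lemma = solve-∀
    c²+v≡2wNc : c * c + v ≡ 2 * w * suc m * c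
    c²+v≡2wNc = begin
      c * c + v                          ≡⟨ lemma₁ c m (w * w) ⟩
      2 * m + c * c + w * w              ≡⟨ cong (_+ w * w) 2xw+w² ⟨
      2 * x * w + w * w + w * w          ≡⟨ lemma₂ x w ⟩
      2 * w * (x + w)                    ≡⟨ cong (2 * w *_) x+w≡Nc ⟩
      2 * w * (suc m * c)                ≡⟨ *-assoc (2 * w) (suc m) c ⟨
      2 * w * suc m * c                  ∎
      where
      open ≡-Reasoning
      lemma₁ : ∀ c m s → c * c + (2 * m + s) ≡ 2 * m + c * c + s
      lemma₁ = solve-∀
      lemma₂ : ∀ x w → 2 * x * w + w * w + w * w ≡ 2 * w * (x + w)
      lemma₂ = solve-∀
    c∣v : c ∣ v
    c∣v = ∣m+n∣m⇒∣n (divides (2 * w * suc m) c²+v≡2wNc) (m∣m*n c)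
    -- Since x + w = N c, c N w = w (x + w) ≤ 2 x w + w² = 2 m + c² ≤ c (1 + c); then c is
    -- cancelled.
    Nw≤1+c : suc m * w ≤ suc c
    Nw≤1+c = *-cancelˡ-≤ c (begin
      c * (suc m * w)           ≡⟨ lemma₁ c m w ⟩
      w * (suc m * c)           ≡⟨ cong (w *_) x+w≡Nc ⟨
      w * (x + w)               ≤⟨ m≤m+n (w * (x + w)) (x * w) ⟩
      w * (x + w) + x * w       ≡⟨ lemma₂ x w ⟩
      2 * x * w + w * w         ≡⟨ 2xw+w² ⟩
      2 * m + c * c             ≤⟨ +-monoˡ-≤ (c * c) 2m≤c ⟩
      c + c * c                 ≡⟨ *-suc c c ⟨
      c * suc c                 ∎)
      where
      open ≤-Reasoning
      lemma₁ : ∀ c m w → c * (suc m * w) ≡ w * (suc m * c)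
      lemma₁ = solve-∀
      lemma₂ : ∀ x w → w * (x + w) + x * w ≡ 2 * x * w + w * w
      lemma₂ = solve-∀
    -- The size hypothesis concerns q = m + 2, not N; q ≤ 2 N costs a factor 2.
    qw≤2[1+c] : (2 + m) * w ≤ 2 * suc c
    qw≤2[1+c] = begin
      (2 + m) * w               ≤⟨ *-monoˡ-≤ w (s≤s (s≤s (m≤n+m m m))) ⟩
      (2 + (m + m)) * w         ≡⟨ lemma m w ⟩
      2 * (suc m * w)           ≤⟨ *-monoʳ-≤ 2 Nw≤1+c ⟩
      2 * suc c                 ∎
      where
      open ≤-Reasoning
      lemma : ∀ m w → (2 + (m + m)) * w ≡ 2 * (suc m * w)
      lemma = solve-∀
    [1+c]²≤2c² : suc c * suc c ≤ 2 * (c * c)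
    [1+c]²≤2c² = begin
      suc c * suc c             ≡⟨ lemma₁ c ⟩
      c * c + 2 * c + 1         ≤⟨ +-monoʳ-≤ (c * c + 2 * c) (s≤s z≤n) ⟩
      c * c + 2 * c + c         ≡⟨ lemma₂ c ⟩
      c * c + 3 * c             ≤⟨ +-monoʳ-≤ (c * c) (*-monoˡ-≤ c (≤-trans (from-yes (3 ≤? 5)) 5≤c)) ⟩
      c * c + c * c             ≡⟨ lemma₃ (c * c) ⟩
      2 * (c * c)               ∎
      where
      open ≤-Reasoning
      lemma₁ : ∀ c → suc c * suc c ≡ c * c + 2 * c + 1
      lemma₁ = solve-∀
      lemma₂ : ∀ c → c * c + 2 * c + c ≡ c * c + 3 * c
      lemma₂ = solve-∀
      lemma₃ : ∀ s → s + s ≡ 2 * s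
      lemma₃ = solve-∀
    -- Squaring the bound on q w gives 64 c w² ≤ q² w² ≤ 4 (1 + c)² ≤ 8 c².
    8w²≤c : 8 * (w * w) ≤ c
    8w²≤c = *-cancelˡ-≤ (8 * c) (begin
      8 * c * (8 * (w * w))           ≡⟨ lemma₁ c (w * w) ⟩
      64 * c * (w * w)                ≤⟨ *-monoˡ-≤ (w * w) 64c≤q² ⟩
      (2 + m) * (2 + m) * (w * w)     ≡⟨ lemma₂ (2 + m) w ⟩
      (2 + m) * w * ((2 + m) * w)     ≤⟨ *-mono-≤ qw≤2[1+c] qw≤2[1+c] ⟩
      2 * suc c * (2 * suc c)         ≡⟨ lemma₃ (suc c) ⟩
      4 * (suc c * suc c)             ≤⟨ *-monoʳ-≤ 4 [1+c]²≤2c² ⟩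
      4 * (2 * (c * c))               ≡⟨ lemma₄ c ⟩
      8 * c * c                       ∎)
      where
      open ≤-Reasoning
      lemma₁ : ∀ c s → 8 * c * (8 * s) ≡ 64 * c * s
      lemma₁ = solve-∀
      lemma₂ : ∀ q w → q * q * (w * w) ≡ q * w * (q * w)
      lemma₂ = solve-∀
      lemma₃ : ∀ s → 2 * s * (2 * s) ≡ 4 * (s * s)
      lemma₃ = solve-∀
      lemma₄ : ∀ c → 4 * (2 * (c * c)) ≡ 8 * c * c
      lemma₄ = solve-∀
    -- Of the 8 c available, 7 c bounds 16 m and the last c bounds 8 w².
    v<c : v < c
    v<c = *-cancelˡ-< 8 v c (begin-strict
      8 * v                           ≡⟨ lemma₁ m (w * w) ⟩
      16 * m + 8 * (w * w)            <⟨ +-monoˡ-< (8 * (w * w)) (*-monoʳ-< 16 (m<n+m m {2} z<s)) ⟩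
      16 * (2 + m) + 8 * (w * w)      ≤⟨ +-mono-≤ 16q≤7c 8w²≤c ⟩
      7 * c + c                       ≡⟨ lemma₂ c ⟩
      8 * c                           ∎)
      where
      open ≤-Reasoning
      lemma₁ : ∀ m s → 8 * (2 * m + s) ≡ 16 * m + 8 * s
      lemma₁ = solve-∀
      lemma₂ : ∀ c → 7 * c + c ≡ 8 * c
      lemma₂ = solve-∀

-- Growth of powers and reduction to the size argument.

-- Exponent 4 is the first at which this holds; from there the right side grows faster.
16*4^n≤7*5^n : ∀ j → 16 * 4 ^ (4 + j) ≤ 7 * 5 ^ (4 + j)
16*4^n≤7*5^n zero = from-yes (4096 ≤? 4375)
16*4^n≤7*5^n (suc j) = subst₂ _≤_ (lemma₁ (4 ^ (4 + j))) (lemma₂ (5 ^ (4 + j)))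
  (*-mono-≤ (n≤1+n 4) (16*4^n≤7*5^n j))
  where
  lemma₁ : ∀ y → 4 * (16 * y) ≡ 16 * (4 * y)
  lemma₁ = solve-∀
  lemma₂ : ∀ z → 5 * (7 * z) ≡ 7 * (5 * z)
  lemma₂ = solve-∀

-- This too starts at exponent 4; each step multiplies the left by 5 and the right by 16.
64*5^n≤4^n*4^n : ∀ j → 64 * 5 ^ (4 + j) ≤ 4 ^ (4 + j) * 4 ^ (4 + j)
64*5^n≤4^n*4^n zero = from-yes (40000 ≤? 65536)
64*5^n≤4^n*4^n (suc j) = subst₂ _≤_ (lemma₁ (5 ^ (4 + j))) (lemma₂ (4 ^ (4 + j)))
  (*-mono-≤ (from-yes (5 ≤? 16)) (64*5^n≤4^n*4^n j))
  where
  lemma₁ : ∀ z → 5 * (64 * z) ≡ 64 * (5 * z)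
  lemma₁ = solve-∀
  lemma₂ : ∀ y → 16 * (y * y) ≡ 4 * y * (4 * y)
  lemma₂ = solve-∀

^-distrib-* : ∀ a b n → (a * b) ^ n ≡ a ^ n * b ^ n
^-distrib-* a b zero = refl
^-distrib-* a b (suc n) = trans (cong (a * b *_) (^-distrib-* a b n)) (lemma a b (a ^ n) (b ^ n))
  where
  lemma : ∀ a b u v → a * b * (u * v) ≡ a * u * (b * v)
  lemma = solve-∀

2^[2k] : ∀ k → 2 ^ (2 * k) ≡ 4 ^ k
2^[2k] k = sym (^-*-assoc 2 2 k)

10^[2k] : ∀ k → 10 ^ (2 * k) ≡ 4 ^ k * (5 ^ k * 5 ^ k)
10^[2k] k = begin
  10 ^ (2 * k)              ≡⟨ ^-*-assoc 10 2 k ⟨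
  100 ^ k                   ≡⟨ ^-distrib-* 4 25 k ⟩
  4 ^ k * 25 ^ k            ≡⟨ cong (4 ^ k *_) (^-distrib-* 5 5 k) ⟩
  4 ^ k * (5 ^ k * 5 ^ k)   ∎
  where open ≡-Reasoning

square-mono-< : ∀ {m n} → m < n → m * m < n * n
square-mono-< m<n = *-mono-< m<n m<n

square-injective : ∀ {m n} → m * m ≡ n * n → m ≡ n
square-injective {m} {n} m²≡n² with <-cmp m n
... | tri< m<n _ _ = contradiction m²≡n² (<⇒≢ (square-mono-< m<n))
... | tri≈ _ m≡n _ = m≡n
... | tri> _ _ n<m = contradiction (sym m²≡n²) (<⇒≢ (square-mono-< n<m))

no-square-between : ∀ {k x} → k * k < x * x → ¬ x * x < suc k * suc k
no-square-between {k} {x} k²<x² x²<[1+k]² with x ≤? k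
... | yes x≤k = <⇒≱ k²<x² (*-mono-≤ x≤k x≤k)
... | no x≰k = <⇒≱ x²<[1+k]² (*-mono-≤ (≰⇒> x≰k) (≰⇒> x≰k))

even-exponent≥8 : ∀ j x → let k = 4 + j in
  (4 ^ k ∸ 2) * (4 ^ k * (5 ^ k * 5 ^ k) ∸ 2) ≡ x * x → ⊥
even-exponent≥8 j x = reduction (4 ^ k) (5 ^ k) 2≤4^k (m^n>0 5 k) (16*4^n≤7*5^n j) (64*5^n≤4^n*4^n j)
  where
  k = 4 + j
  2≤4^k : 2 ≤ 4 ^ k
  2≤4^k = ≤-trans (from-yes (2 ≤? 4)) (m≤m*n 4 (4 ^ (3 + j)) {{m^n≢0 4 (3 + j)}})
  -- With 4^k and 5^k replaced by variables, q can be matched as 2 + m, which makes the truncated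
  -- subtraction compute.
  reduction : ∀ q c → 2 ≤ q → c > 0 → 16 * q ≤ 7 * c → 64 * c ≤ q * q →
    (q ∸ 2) * (q * (c * c) ∸ 2) ≡ x * x → ⊥
  reduction (suc (suc m)) c _ c>0 16q≤7c 64c≤q² eq =
    even-exponent-large m c x (begin
      m * y                     ≡⟨ cong (m *_) (m∸n+n≡m 2≤y) ⟨
      m * (y ∸ 2 + 2)           ≡⟨ lemma m (y ∸ 2) ⟩
      m * (y ∸ 2) + 2 * m       ≡⟨ cong (_+ 2 * m) eq ⟩
      x * x + 2 * m             ∎) 16q≤7c 64c≤q²
    where
    open ≡-Reasoning
    y = (2 + m) * (c * c)
    2≤y : 2 ≤ y
    2≤y = *-mono-≤ (m≤m+n 2 m) (*-mono-≤ c>0 c>0)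
    lemma : ∀ m z → m * (z + 2) ≡ m * z + 2 * m
    lemma = solve-∀
  reduction 0 _ ()
  reduction 1 _ (s≤s ())

even-exponent : ∀ k x → k > 0 → (2 ^ (2 * k) ∸ 2) * (10 ^ (2 * k) ∸ 2) ≡ x * x →
  (2 * k ≡ 2 × x ≡ 14) ⊎ (2 * k ≡ 6 × x ≡ 7874)
even-exponent 1 x _ eq = inj₁ (refl , square-injective (sym eq))
-- For n = 4 the product 14 * 9998 = 139972 lies strictly between 374² and 375².
even-exponent 2 x _ eq = contradiction (subst (_< 375 * 375) eq (from-yes (139972 <? 375 * 375)))
  (no-square-between {374} {x} (subst (374 * 374 <_) eq (from-yes (374 * 374 <? 139972))))
even-exponent 3 x _ eq = inj₂ (refl , square-injective (sym eq))
even-exponent k@(suc (suc (suc (suc j)))) x _ eq = ⊥-elim (even-exponent≥8 j x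
  (trans (sym (cong₂ (λ u v → (u ∸ 2) * (v ∸ 2)) (2^[2k] k) (10^[2k] k))) eq))

-- Odd exponents and the final equivalence.

2*suc∸2 : ∀ p → 2 * suc p ∸ 2 ≡ 2 * p
2*suc∸2 p = cong (_∸ 2) (*-suc 2 p)

-- With u = 10^k, 2^n - 2 = 2 (4^k - 1) and 10^n - 2 = 2 (5 u² - 1); the two factors 2 make up the 4
-- beside c.
odd-exponent-impossible : ∀ k x → k > 0 → (2 ^ (1 + 2 * k) ∸ 2) * (10 ^ (1 + 2 * k) ∸ 2) ≡ x * x → ⊥
odd-exponent-impossible k x k>0 eq = no-square-odd-exponent k a c (10 ^ k) x k>0 1+a≡4^k 1+c≡5u² (begin
  a * (4 * c)                                            ≡⟨ lemma a c ⟩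
  2 * a * (2 * c)                                        ≡⟨ cong₂ _*_ (2*suc∸2 a) (2*suc∸2 c) ⟨
  (2 * suc a ∸ 2) * (2 * suc c ∸ 2)                      ≡⟨ cong₂ (λ u v → (u ∸ 2) * (v ∸ 2)) 2[1+a] 2[1+c] ⟩
  (2 ^ (1 + 2 * k) ∸ 2) * (10 ^ (1 + 2 * k) ∸ 2)         ≡⟨ eq ⟩
  x * x                                                  ∎)
  where
  open ≡-Reasoning
  a = pred (4 ^ k)
  c = pred (5 * (10 ^ k * 10 ^ k))
  1+a≡4^k : suc a ≡ 4 ^ k
  1+a≡4^k = suc-pred (4 ^ k) {{m^n≢0 4 k}}
  1+c≡5u² : suc c ≡ 5 * (10 ^ k * 10 ^ k)
  1+c≡5u² = suc-pred _ {{m*n≢0 5 _ {{_}} {{m*n≢0 (10 ^ k) (10 ^ k) {{m^n≢0 10 k}} {{m^n≢0 10 k}}}}}}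
  lemma : ∀ a c → a * (4 * c) ≡ 2 * a * (2 * c)
  lemma = solve-∀
  2[1+a] : 2 * suc a ≡ 2 ^ (1 + 2 * k)
  2[1+a] = cong (2 *_) (trans 1+a≡4^k (sym (2^[2k] k)))
  2[1+c] : 2 * suc c ≡ 10 ^ (1 + 2 * k)
  2[1+c] = begin
    2 * suc c                        ≡⟨ cong (2 *_) 1+c≡5u² ⟩
    2 * (5 * (10 ^ k * 10 ^ k))      ≡⟨ *-assoc 2 5 (10 ^ k * 10 ^ k) ⟨
    10 * (10 ^ k * 10 ^ k)           ≡⟨ cong (10 *_) (^-distrib-* 10 10 k) ⟨
    10 * 100 ^ k                     ≡⟨ cong (10 *_) (^-*-assoc 10 2 k) ⟩
    10 ^ (1 + 2 * k)                 ∎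

x^2≡x*x : ∀ x → x ^ 2 ≡ x * x
x^2≡x*x x = cong (x *_) (*-identityʳ x)

theorem27 : ∀ (n x : ℕ) →
    (n ≥ 2 × x ≥ 1 × (2 ^ n ∸ 2) * (10 ^ n ∸ 2) ≡ x ^ 2)
    ⇔ ((n ≡ 2 × x ≡ 14) ⊎ (n ≡ 6 × x ≡ 7874))
theorem27 n x = mk⇔ (solutions (even⊎odd n)) verify
  where
  solutions : ∃ (λ k → n ≡ 2 * k ⊎ n ≡ 1 + 2 * k) →
    n ≥ 2 × x ≥ 1 × (2 ^ n ∸ 2) * (10 ^ n ∸ 2) ≡ x ^ 2 →
    (n ≡ 2 × x ≡ 14) ⊎ (n ≡ 6 × x ≡ 7874)
  solutions (zero , inj₁ refl) (() , _)
  solutions (zero , inj₂ refl) (s≤s () , _)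
  solutions (k@(suc _) , inj₁ refl) (_ , _ , eq) =
    even-exponent k x z<s (trans eq (x^2≡x*x x))
  solutions (k@(suc _) , inj₂ refl) (_ , _ , eq) =
    ⊥-elim (odd-exponent-impossible k x z<s (trans eq (x^2≡x*x x)))
  verify : (n ≡ 2 × x ≡ 14) ⊎ (n ≡ 6 × x ≡ 7874) →
    n ≥ 2 × x ≥ 1 × (2 ^ n ∸ 2) * (10 ^ n ∸ 2) ≡ x ^ 2
  verify (inj₁ (refl , refl)) = s≤s (s≤s z≤n) , s≤s z≤n , refl
  verify (inj₂ (refl , refl)) = s≤s (s≤s z≤n) , s≤s z≤n , refl
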